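{- The class of all finite posets, with quotient maps as morphisms, is directed and has the amalgamation property in the following sense. (Directedness) For any finite posets $A,B$ there is a finite poset $C$ and quotient maps $C\to A$ and $C\to B$. (Amalgamation) For any finite posets $A,B,C$ and quotient maps $f:B\to A$, $g:C\to A$, there exist a finite poset $D$ and quotient maps $f':D\to B$, $g':D\to C$ such that $f\circ f'=g\circ g'$.
   Context: For posets $(A,\le_A),(B,\le_B)$, a map $\phi:A\to B$ is an order homomorphism if $x\le_A y$ implies $\phi(x)\le_B\phi(y)$. A quotient map is a surjective order homomorphism $\phi:A\to B$ such that for all $p,r\in B$ with $p\le_B r$ there exist $x,y\in A$ with $x\le_A y$, $\phi(x)=p$, $\phi(y)=r$.
   Formalization: In directedness, A and B are assumed nonempty, since the claim fails when exactly one of them is empty (a quotient map onto the empty poset has empty domain); amalgamation is stated for all finite posets. -}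

module Defs where

open import Data.Fin.Base using (Fin)
open import Data.Nat.Base using (ℕ)
open import Data.Product.Base using (∃; ∃₂; _×_)
open import Function.Bundles using (Inverse)
open import Function.Definitions using (Surjective)
open import Level using (0ℓ)
open import Relation.Binary.Bundles using (Setoid; Poset)
open import Relation.Binary.Morphism.Bundles using (PosetHomomorphism)
import Relation.Binary.PropositionalEquality as ≡

IsFinite : Setoid 0ℓ 0ℓ → Set
IsFinite S = ∃ λ (n : ℕ) → Inverse S (≡.setoid (Fin n))

-- The empty poset is allowed.
record FinitePoset : Set₁ where
  field
    poset : Poset 0ℓ 0ℓ 0ℓ

  open Poset poset public

  field
    finite : IsFinite Eq.setoid

record QuotientMap (A B : FinitePoset) : Set where
  private
    module A = FinitePoset A
    module B = FinitePoset B

  field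
    homomorphism : PosetHomomorphism A.poset B.poset

  open PosetHomomorphism homomorphism public

  field
    surjective : Surjective A._≈_ B._≈_ ⟦_⟧
    lift-≤     : ∀ p r → p B.≤ r →
                 ∃₂ λ x y → x A.≤ y × ⟦ x ⟧ B.≈ p × ⟦ y ⟧ B.≈ r

-- Empty A and B have to be excluded: a quotient map onto the empty poset has
-- empty domain, so the empty poset and a nonempty one have no common C.
Directed : Set₁
Directed =
  (A B : FinitePoset) → FinitePoset.Carrier A → FinitePoset.Carrier B →
  ∃ λ (C : FinitePoset) → QuotientMap C A × QuotientMap C B

Amalgamation : Set₁
Amalgamation =
  (A B C : FinitePoset) (f : QuotientMap B A) (g : QuotientMap C A) →
  let open FinitePoset A using (_≈_)
      module f = QuotientMap f
      module g = QuotientMap g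
  in
  ∃ λ (D : FinitePoset) →
  ∃₂ λ (f′ : QuotientMap D B) (g′ : QuotientMap D C) →
  ∀ d → f.⟦ QuotientMap.⟦_⟧ f′ d ⟧ ≈ g.⟦ QuotientMap.⟦_⟧ g′ d ⟧

{-# OPTIONS --safe #-}
-- The set-theoretic pullback of two quotient maps f : B → A and g : C → A, with
-- the componentwise order, is an amalgam: b ≤ b′ in B maps to f b ≤ f b′ in A,
-- which g lifts to c ≤ c′ in C, so (b , c) ≤ (b′ , c′) lies over b ≤ b′.
-- Directedness is amalgamation over the one-point poset.
module Submission where

open import Defs
open import Data.Fin.Base using (Fin; zero; suc)
open import Data.Fin.Properties using (_≟_; suc-injective; *↔×; 1↔⊤)
open import Data.Nat.Base using (zero; suc)
open import Data.Product.Base using (∃; _×_; _,_; proj₁; proj₂; map)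
open import Data.Product.Function.NonDependent.Setoid using (_×-inverse_)
open import Data.Product.Relation.Binary.Pointwise.NonDependent
  using (_×ₛ_; ×-poset; Pointwise-≡↔≡)
open import Data.Unit.Base using (tt)
open import Data.Unit.Properties using (≡-poset)
open import Function.Base using (_∘_; id)
open import Function.Bundles using (Inverse)
import Function.Construct.Composition as Compose
import Function.Construct.Symmetry as Symmetry
open import Function.Properties.Inverse using (Inverse⇒Injection)
open import Level using (0ℓ)
open import Relation.Binary.Bundles using (Setoid)
open import Relation.Binary.Definitions using (_Respects_)
  renaming (Decidable to Decidable₂)
import Relation.Binary.Construct.On as On
open import Relation.Binary.Morphism.Bundles using (mkPosetHomo)
open import Relation.Binary.PropositionalEquality as ≡ using (refl; cong)
open import Relation.Nullary using (yes; no; contradiction)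
open import Relation.Nullary.Decidable using (via-injection)
open import Relation.Unary using (Pred; Decidable)

-- Equality looks only at first components, so an element counts once however many proofs of `P` it
-- has; this makes counting sound for an arbitrary predicate.
subsetoid : (S : Setoid 0ℓ 0ℓ) → Pred (Setoid.Carrier S) 0ℓ → Setoid 0ℓ 0ℓ
subsetoid S P = On.setoid S (proj₁ {B = P})

-- Induction on `n`: the enumeration of the members above `zero` is kept as it is when `P` fails at
-- `zero`, and is shifted by one to make room for `zero` when `P` holds there.
Fin-subsetoid-finite : ∀ n {P : Pred (Fin n) 0ℓ} → Decidable P →
                       IsFinite (subsetoid (≡.setoid (Fin n)) P)
Fin-subsetoid-finite zero P? = 0 , record
  { to        = proj₁
  ; from      = λ ()
  ; to-cong   = id
  ; from-cong = λ { {()} }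
  ; inverse   = (λ { {()} }) , λ { {() , _} }
  }
Fin-subsetoid-finite (suc n) {P} P? with P? zero | Fin-subsetoid-finite n (P? ∘ suc)
... | yes p₀ | k , I = suc k , record
  { to        = to′
  ; from      = from′
  ; to-cong   = λ { {zero , _}  {zero , _}   refl → refl
                  ; {suc _ , _} {suc _ , _}  refl → cong suc (to-cong refl) }
  ; from-cong = λ { refl → refl }
  ; inverse   = (λ { {zero}  {zero , _}  _  → refl
                   ; {suc _} {suc _ , _} eq → cong suc (inverseˡ (suc-injective eq)) })
              , (λ { {zero , _}  refl → refl
                   ; {suc _ , _} refl → cong suc (inverseʳ refl) })
  }
  where
  open Inverse I
  to′ : ∃ P → Fin (suc k)
  to′ (zero  , _) = zero
  to′ (suc i , p) = suc (to (i , p))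
  from′ : Fin (suc k) → ∃ P
  from′ zero    = zero , p₀
  from′ (suc j) = map suc id (from j)
... | no ¬p₀ | k , I = k , record
  { to        = to′
  ; from      = map suc id ∘ from
  ; to-cong   = λ { {zero , p}  {_}         _    → contradiction p ¬p₀
                  ; {suc _ , _} {suc _ , _} refl → to-cong refl }
  ; from-cong = λ { refl → refl }
  ; inverse   = (λ { {_} {suc _ , _} eq → inverseˡ (suc-injective eq) })
              , (λ { {zero , p}     _ → contradiction p ¬p₀
                   ; {suc _ , _} refl → cong suc (inverseʳ refl) })
  }
  where
  open Inverse I
  to′ : ∃ P → Fin k
  to′ (zero  , p) = contradiction p ¬p₀
  to′ (suc i , p) = to (i , p)

module _ {S : Setoid 0ℓ 0ℓ} where
  open Setoid S using (_≈_; sym)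

  -- Elements are equal exactly when their indices are. This is what makes membership in the
  -- pullback decidable.
  ≈-decidable : IsFinite S → Decidable₂ _≈_
  ≈-decidable (_ , I) = via-injection (Inverse⇒Injection I) _≟_

  subsetoid-finite : IsFinite S → {P : Pred (Setoid.Carrier S) 0ℓ} →
                     P Respects _≈_ → Decidable P → IsFinite (subsetoid S P)
  subsetoid-finite (n , I) {P} resp P? =
    map id (Compose.inverse restricted) (Fin-subsetoid-finite n (P? ∘ from))
    where
    open Inverse I
    restricted : Inverse (subsetoid S P) (subsetoid (≡.setoid (Fin n)) (P ∘ from))
    restricted = record
      -- The target asks for `P (from (to x))`, and `from (to x)` is only `≈` to `x`; hence the
      -- hypothesis `resp`.
      { to        = λ (x , p) → to x , resp (sym (strictlyInverseʳ x)) p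
      ; from      = map from id
      ; to-cong   = to-cong
      ; from-cong = from-cong
      ; inverse   = inverseˡ , inverseʳ
      }

×-finite : {S T : Setoid 0ℓ 0ℓ} → IsFinite S → IsFinite T → IsFinite (S ×ₛ T)
×-finite (_ , I) (_ , J) =
  _ , Compose.inverse (I ×-inverse J)
        -- Pairs of indices come with componentwise equality, which must become propositional before
        -- `*↔×` can number them.
        (Compose.inverse Pointwise-≡↔≡ (Symmetry.inverse *↔×))

module Pullback {A B C : FinitePoset} (f : QuotientMap B A) (g : QuotientMap C A) where
  private
    module A = FinitePoset A
    module B = FinitePoset B
    module C = FinitePoset C
    module f = QuotientMap f
    module g = QuotientMap g

  Compatible : Pred (B.Carrier × C.Carrier) 0ℓ
  Compatible (b , c) = f.⟦ b ⟧ A.≈ g.⟦ c ⟧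

  pullback : FinitePoset
  pullback = record
    { poset  = On.poset (×-poset B.poset C.poset) (proj₁ {B = Compatible})
    -- The pullback is cut out of a finite product by an equation in `A`, which is decidable because
    -- `A` is finite.
    ; finite = subsetoid-finite (×-finite B.finite C.finite)
        (λ (b≈b′ , c≈c′) fb≈gc →
          A.Eq.trans (f.cong (B.Eq.sym b≈b′)) (A.Eq.trans fb≈gc (g.cong c≈c′)))
        (λ (b , c) → ≈-decidable A.finite f.⟦ b ⟧ g.⟦ c ⟧)
    }

  π₁ : QuotientMap pullback B
  π₁ = record
    { homomorphism = mkPosetHomo _ _ (proj₁ ∘ proj₁) proj₁
    ; surjective   = λ b → let c , gc≈fb = g.surjective f.⟦ b ⟧ in
        -- `Surjective` quantifies over everything equal to the chosen preimage: `C.Eq.refl` picks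
        -- the preimage itself, and `proj₁` handles any pair equal to `(b , c)`.
        ((b , c) , A.Eq.sym (gc≈fb C.Eq.refl)) , proj₁
    ; lift-≤       = λ b b′ b≤b′ →
        let c , c′ , c≤c′ , gc≈fb , gc′≈fb′ = g.lift-≤ _ _ (f.mono b≤b′) in
        ((b , c) , A.Eq.sym gc≈fb) , ((b′ , c′) , A.Eq.sym gc′≈fb′) ,
        (b≤b′ , c≤c′) , B.Eq.refl , B.Eq.refl
    }

  π₂ : QuotientMap pullback C
  π₂ = record
    { homomorphism = mkPosetHomo _ _ (proj₂ ∘ proj₁) proj₂
    ; surjective   = λ c → let b , fb≈gc = f.surjective g.⟦ c ⟧ in
        ((b , c) , fb≈gc B.Eq.refl) , proj₂
    ; lift-≤       = λ c c′ c≤c′ →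
        let b , b′ , b≤b′ , fb≈gc , fb′≈gc′ = f.lift-≤ _ _ (g.mono c≤c′) in
        ((b , c) , fb≈gc) , ((b′ , c′) , fb′≈gc′) ,
        (b≤b′ , c≤c′) , C.Eq.refl , C.Eq.refl
    }

amalgamation : Amalgamation
-- The square commutes because each element of the pullback carries its own proof of compatibility,
-- extracted by `proj₂`.
amalgamation A B C f g = pullback , π₁ , π₂ , proj₂
  where open Pullback {A} {B} {C} f g

⊤-finitePoset : FinitePoset
⊤-finitePoset = record { poset = ≡-poset ; finite = 1 , Symmetry.inverse 1↔⊤ }

-- Nonemptiness enters here: `a` is the preimage of the point, and `a ≤ a` lifts the only relation
-- of the one-point poset.
toPoint : (A : FinitePoset) → FinitePoset.Carrier A → QuotientMap A ⊤-finitePoset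
toPoint A a = record
  { homomorphism = mkPosetHomo _ _ (λ _ → tt) (λ _ → refl)
  ; surjective   = λ _ → a , λ _ → refl
  ; lift-≤       = λ _ _ _ → a , a , FinitePoset.refl A , refl , refl
  }

directed : Directed
directed A B a b =
  let C , π₁ , π₂ , _ = amalgamation ⊤-finitePoset A B (toPoint A a) (toPoint B b)
  in C , π₁ , π₂

mainTheorem1 : Directed × Amalgamation
mainTheorem1 = directed , amalgamation
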